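{- Let $q$ be a prime power, $\mathbb{A}=\mathbb{F}_q[t]$, and let $f,g\in\mathbb{A}$ be non-constant polynomials. Let $g=\alpha P_1^{e_1}\cdots P_r^{e_r}$ be the prime factorization of $g$, where $\alpha\in\mathbb{F}_q^*$, each $e_i\ge 1$, and $P_1,\dots,P_r$ are pairwise distinct monic irreducible polynomials of positive degree over $\mathbb{F}_q$. Then every function $\sigma:\mathbb{A}_f\to\mathbb{A}_g$ is congruence preserving if and only if $\deg f\le\deg P_i$ for every $1\le i\le r$.
   Context: $\mathbb{F}_q$ is the finite field with $q$ elements and $\mathbb{A}=\mathbb{F}_q[t]$. For a non-constant $f\in\mathbb{A}$, $\mathbb{A}_f=\mathbb{A}/f\mathbb{A}$ is the residue class ring modulo $f$, and $\mathcal{A}_f=\{h\in\mathbb{A}:\deg h<\deg f\}\cup\{0\}$, a complete set of representatives of the residue classes modulo $f$; for $h\in\mathcal{A}_f$, $\bar h$ denotes the residue class of $h$ modulo $f$. A function $\sigma:\mathbb{A}_f\to\mathbb{A}_g$ is called congruence preserving if for all $h_1,h_2\in\mathcal{A}_f$ and every $h\in\mathbb{A}$ dividing $g$, $h_1\equiv h_2\pmod h$ implies $\sigma(\bar h_1)\equiv\sigma(\bar h_2)\pmod h$ (here $h_1,h_2$ are regarded as elements of $\mathbb{A}$, and reduction modulo $h$ of elements of $\mathbb{A}_g$ is well defined since $h\mid g$). -}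

module Defs where

open import Algebra.Bundles using (CommutativeRing; Semiring)
import Algebra.Definitions.RawSemiring as RawSemiringDefinitions
import Algebra.Properties.Ring as RingProperties
import Algebra.Properties.AbelianGroup as AbelianGroupProperties
import Algebra.Properties.CommutativeSemigroup as CommutativeSemigroupProperties
import Algebra.Properties.Semiring.Divisibility as Divisibility
open import Data.Bool.Base using (if_then_else_)
open import Data.Fin.Base using (Fin)
open import Data.List.Base using (List; []; _∷_; map)
open import Data.List.Relation.Unary.All using (all?)
open import Data.Nat.Base as ℕ using (ℕ; zero; suc)
import Data.Fin.Properties as Fin
open import Data.Product.Base using (_×_; _,_; ∃-syntax)
open import Data.Sum.Base using (_⊎_)
open import Function.Bundles using (Func; Inverse)
open import Function.Properties.Inverse using (Inverse⇒Injection)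
open import Level using (Level; _⊔_) renaming (suc to lsuc)
open import Relation.Binary.Bundles using (Setoid)
open import Relation.Binary.Definitions using (Decidable)
import Relation.Binary.PropositionalEquality as ≡
import Relation.Binary.Reasoning.Setoid as SetoidReasoning
open import Relation.Nullary.Decidable using (does; via-injection)
open import Relation.Nullary.Negation using (¬_)

record FiniteField (c ℓ : Level) (q : ℕ) : Set (lsuc (c ⊔ ℓ)) where
  field
    commutativeRing : CommutativeRing c ℓ

  open CommutativeRing commutativeRing public

  field
    0≉1         : ¬ 0# ≈ 1#
    invertible  : ∀ x → ¬ x ≈ 0# → ∃[ y ] x * y ≈ 1#
    enumeration : Inverse setoid (≡.setoid (Fin q))

  infix 4 _≟_
  _≟_ : Decidable _≈_
  _≟_ = via-injection (Inverse⇒Injection enumeration) Fin._≟_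

-- The residue class ring R / fR.  There are no quotient types, so a residue
-- class is given by any representative in R, and the class of h is h itself;
-- what changes is the equality.

module Quotient {c ℓ} (R : CommutativeRing c ℓ) where

  open CommutativeRing R
  open Divisibility semiring
    using (_∣_; _,_; _∣0; ∣-trans; ∣-respʳ; x∣ʳy⇒x∣ʳzy)
  open RingProperties ring
    using (-‿distribˡ-*; -‿distribʳ-*; -‿+-comm; -‿involutive)
  open CommutativeSemigroupProperties +-commutativeSemigroup using (interchange)
  open SetoidReasoning setoid

  infix 4 _≡_[mod_]
  _≡_[mod_] : Carrier → Carrier → Carrier → Set (c ⊔ ℓ)
  x ≡ y [mod f ] = f ∣ x - y

  private
    ∣-+ : ∀ {f x y} → f ∣ x → f ∣ y → f ∣ x + y
    ∣-+ {f} (u , uf≈x) (v , vf≈y) = u + v , trans (distribʳ f u v) (+-cong uf≈x vf≈y)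

    ∣-neg : ∀ {f x} → f ∣ x → f ∣ - x
    ∣-neg {f} (u , uf≈x) = - u , trans (sym (-‿distribˡ-* u f)) (-‿cong uf≈x)

    -‿flip : ∀ x y → - (x - y) ≈ y - x
    -‿flip x y = begin
      - (x - y)      ≈⟨ -‿+-comm x (- y) ⟨
      - x + - (- y)  ≈⟨ +-congˡ (-‿involutive y) ⟩
      - x + y        ≈⟨ +-comm (- x) y ⟩
      y - x          ∎

    telescope : ∀ x y z → (x - y) + (y - z) ≈ x - z
    telescope x y z = begin
      (x - y) + (y - z)      ≈⟨ +-assoc x (- y) (y - z) ⟩
      x + (- y + (y - z))    ≈⟨ +-congˡ (+-assoc (- y) y (- z)) ⟨
      x + ((- y + y) - z)    ≈⟨ +-congˡ (+-congʳ (-‿inverseˡ y)) ⟩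
      x + (0# - z)           ≈⟨ +-congˡ (+-identityˡ (- z)) ⟩
      x - z                  ∎

    reflexive-mod : ∀ {f x y} → x ≈ y → x ≡ y [mod f ]
    reflexive-mod {f} {x} {y} x≈y =
      ∣-respʳ (sym (trans (+-congʳ x≈y) (-‿inverseʳ y))) (f ∣0)

    +-cong-mod : ∀ {f x y u v} → x ≡ y [mod f ] → u ≡ v [mod f ] → x + u ≡ y + v [mod f ]
    +-cong-mod {f} {x} {y} {u} {v} p q =
      ∣-respʳ (trans (interchange x (- y) u (- v)) (+-congˡ (-‿+-comm y v))) (∣-+ p q)

    -‿cong-mod : ∀ {f x y} → x ≡ y [mod f ] → - x ≡ - y [mod f ]
    -‿cong-mod {f} {x} {y} p = ∣-respʳ (sym (-‿+-comm x (- y))) (∣-neg p)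

    *-cong-mod : ∀ {f x y u v} → x ≡ y [mod f ] → u ≡ v [mod f ] → x * u ≡ y * v [mod f ]
    *-cong-mod {f} {x} {y} {u} {v} p q = ∣-respʳ eq (∣-+ (x∣ʳy⇒x∣ʳzy u p) (x∣ʳy⇒x∣ʳzy y q))
      where
      eq : u * (x - y) + y * (u - v) ≈ x * u - y * v
      eq = begin
        u * (x - y) + y * (u - v)                ≈⟨ +-cong (*-comm u (x - y)) (distribˡ y u (- v)) ⟩
        (x - y) * u + (y * u + y * - v)          ≈⟨ +-cong (distribʳ u x (- y)) (+-congˡ (sym (-‿distribʳ-* y v))) ⟩
        (x * u + - y * u) + (y * u - y * v)      ≈⟨ +-congʳ (+-congˡ (sym (-‿distribˡ-* y u))) ⟩
        (x * u - y * u) + (y * u - y * v)        ≈⟨ telescope (x * u) (y * u) (y * v) ⟩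
        x * u - y * v                            ∎

  infix 9 _/_
  _/_ : Carrier → CommutativeRing c (c ⊔ ℓ)
  _/_ f = record
    { Carrier = Carrier
    ; _≈_     = _≡_[mod f ]
    ; _+_     = _+_
    ; _*_     = _*_
    ; -_      = -_
    ; 0#      = 0#
    ; 1#      = 1#
    ; isCommutativeRing = record
      { isRing = record
        { +-isAbelianGroup = record
          { isGroup = record
            { isMonoid = record
              { isSemigroup = record
                { isMagma = record
                  { isEquivalence = record
                    { refl  = reflexive-mod refl
                    ; sym   = λ {x} {y} p → ∣-respʳ (-‿flip x y) (∣-neg p)
                    ; trans = λ {x} {y} {z} p q → ∣-respʳ (telescope x y z) (∣-+ p q)
                    }
                  ; ∙-cong = +-cong-mod
                  }
                ; assoc = λ x y z → reflexive-mod (+-assoc x y z)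
                }
              ; identity = (λ x → reflexive-mod (+-identityˡ x))
                         , (λ x → reflexive-mod (+-identityʳ x))
              }
            ; inverse = (λ x → reflexive-mod (-‿inverseˡ x))
                      , (λ x → reflexive-mod (-‿inverseʳ x))
            ; ⁻¹-cong = -‿cong-mod
            }
          ; comm = λ x y → reflexive-mod (+-comm x y)
          }
        ; *-cong     = *-cong-mod
        ; *-assoc    = λ x y z → reflexive-mod (*-assoc x y z)
        ; *-identity = (λ x → reflexive-mod (*-identityˡ x))
                     , (λ x → reflexive-mod (*-identityʳ x))
        ; distrib    = (λ x y z → reflexive-mod (distribˡ x y z))
                     , (λ x y z → reflexive-mod (distribʳ x y z))
        }
      ; *-comm = λ x y → reflexive-mod (*-comm x y)
      }
    }

  -- Reduction modulo a divisor h of g is well defined on R / gR.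
  reduction : ∀ {h g} → h ∣ g →
              Func (CommutativeRing.setoid (_/_ g)) (CommutativeRing.setoid (_/_ h))
  reduction h∣g = record { to = λ x → x ; cong = ∣-trans h∣g }

-- Univariate polynomials over a commutative ring.  The list
-- a₀ ∷ a₁ ∷ … ∷ aₙ ∷ [] stands for a₀ + a₁t + … + aₙtⁿ; trailing zeros are
-- allowed, and equality is equality of all coefficients.

module UnivariatePolynomials {c ℓ} (R : CommutativeRing c ℓ) where

  private
    module R = CommutativeRing R
    module RP = RingProperties R.ring
    module RA = AbelianGroupProperties R.+-abelianGroup
  open R using () renaming (Carrier to K)

  Poly : Set c
  Poly = List K

  coeff : Poly → ℕ → K
  coeff []      _       = R.0#
  coeff (a ∷ p) zero    = a
  coeff (a ∷ p) (suc n) = coeff p n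

  infix 4 _≈ₚ_
  record _≈ₚ_ (p q : Poly) : Set ℓ where
    constructor mk≈
    field coeff-≈ : ∀ n → coeff p n R.≈ coeff q n
  open _≈ₚ_ public

  const : K → Poly
  const a = a ∷ []

  infixl 6 _+ₚ_
  infixl 7 _*ₚ_ _·_
  infix  8 -ₚ_

  _+ₚ_ : Poly → Poly → Poly
  []      +ₚ q       = q
  (a ∷ p) +ₚ []      = a ∷ p
  (a ∷ p) +ₚ (b ∷ q) = (a R.+ b) ∷ (p +ₚ q)

  -ₚ_ : Poly → Poly
  -ₚ_ = map (R.-_)

  _·_ : K → Poly → Poly
  a · p = map (a R.*_) p

  _*ₚ_ : Poly → Poly → Poly
  []      *ₚ q = []
  (a ∷ p) *ₚ q = (a · q) +ₚ (R.0# ∷ (p *ₚ q))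

  private
    reflₚ : ∀ {p} → p ≈ₚ p
    reflₚ = mk≈ λ _ → R.refl

    symₚ : ∀ {p q} → p ≈ₚ q → q ≈ₚ p
    symₚ e = mk≈ λ n → R.sym (coeff-≈ e n)

    transₚ : ∀ {p q r} → p ≈ₚ q → q ≈ₚ r → p ≈ₚ r
    transₚ e e′ = mk≈ λ n → R.trans (coeff-≈ e n) (coeff-≈ e′ n)

    setoidₚ : Setoid c ℓ
    setoidₚ = record
      { Carrier = Poly
      ; _≈_ = _≈ₚ_
      ; isEquivalence = record { refl = reflₚ ; sym = symₚ ; trans = transₚ }
      }

    open SetoidReasoning setoidₚ

    coeff-+ : ∀ p q n → coeff (p +ₚ q) n R.≈ coeff p n R.+ coeff q n
    coeff-+ []      q       n       = R.sym (R.+-identityˡ _)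
    coeff-+ (a ∷ p) []      n       = R.sym (R.+-identityʳ _)
    coeff-+ (a ∷ p) (b ∷ q) zero    = R.refl
    coeff-+ (a ∷ p) (b ∷ q) (suc n) = coeff-+ p q n

    coeff-neg : ∀ p n → coeff (-ₚ p) n R.≈ R.- coeff p n
    coeff-neg []      n       = R.sym RA.ε⁻¹≈ε
    coeff-neg (a ∷ p) zero    = R.refl
    coeff-neg (a ∷ p) (suc n) = coeff-neg p n

    coeff-· : ∀ a p n → coeff (a · p) n R.≈ a R.* coeff p n
    coeff-· a []      n       = R.sym (R.zeroʳ a)
    coeff-· a (b ∷ p) zero    = R.refl
    coeff-· a (b ∷ p) (suc n) = coeff-· a p n

    ∷-cong : ∀ {a b p q} → a R.≈ b → p ≈ₚ q → a ∷ p ≈ₚ b ∷ q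
    ∷-cong a≈b p≈q = mk≈ λ { zero → a≈b ; (suc n) → coeff-≈ p≈q n }

    0∷[]≈[] : R.0# ∷ [] ≈ₚ []
    0∷[]≈[] = mk≈ λ { zero → R.refl ; (suc n) → R.refl }

    +-congₚ : ∀ {p p′ q q′} → p ≈ₚ p′ → q ≈ₚ q′ → p +ₚ q ≈ₚ p′ +ₚ q′
    +-congₚ {p} {p′} {q} {q′} e e′ = mk≈ λ n →
      R.trans (coeff-+ p q n)
        (R.trans (R.+-cong (coeff-≈ e n) (coeff-≈ e′ n)) (R.sym (coeff-+ p′ q′ n)))

    +-commₚ : ∀ p q → p +ₚ q ≈ₚ q +ₚ p
    +-commₚ p q = mk≈ λ n →
      R.trans (coeff-+ p q n) (R.trans (R.+-comm _ _) (R.sym (coeff-+ q p n)))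

    +-assocₚ : ∀ p q r → (p +ₚ q) +ₚ r ≈ₚ p +ₚ (q +ₚ r)
    +-assocₚ p q r = mk≈ λ n →
      R.trans (coeff-+ (p +ₚ q) r n)
        (R.trans (R.+-congʳ (coeff-+ p q n))
          (R.trans (R.+-assoc _ _ _)
            (R.trans (R.+-congˡ (R.sym (coeff-+ q r n)))
              (R.sym (coeff-+ p (q +ₚ r) n)))))

    +-identityʳₚ : ∀ p → p +ₚ [] ≈ₚ p
    +-identityʳₚ p = +-commₚ p []

    +-inverseʳₚ : ∀ p → p +ₚ (-ₚ p) ≈ₚ []
    +-inverseʳₚ p = mk≈ λ n →
      R.trans (coeff-+ p (-ₚ p) n)
        (R.trans (R.+-congˡ (coeff-neg p n)) (R.-‿inverseʳ _))

    -‿congₚ : ∀ {p q} → p ≈ₚ q → -ₚ p ≈ₚ -ₚ q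
    -‿congₚ {p} {q} e = mk≈ λ n →
      R.trans (coeff-neg p n) (R.trans (R.-‿cong (coeff-≈ e n)) (R.sym (coeff-neg q n)))

    +-interchangeₚ : ∀ p q r s → (p +ₚ q) +ₚ (r +ₚ s) ≈ₚ (p +ₚ r) +ₚ (q +ₚ s)
    +-interchangeₚ p q r s = begin
      (p +ₚ q) +ₚ (r +ₚ s)   ≈⟨ +-assocₚ p q (r +ₚ s) ⟩
      p +ₚ (q +ₚ (r +ₚ s))   ≈⟨ +-congₚ (reflₚ {p}) (+-assocₚ q r s) ⟨
      p +ₚ ((q +ₚ r) +ₚ s)   ≈⟨ +-congₚ (reflₚ {p}) (+-congₚ (+-commₚ q r) (reflₚ {s})) ⟩
      p +ₚ ((r +ₚ q) +ₚ s)   ≈⟨ +-congₚ (reflₚ {p}) (+-assocₚ r q s) ⟩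
      p +ₚ (r +ₚ (q +ₚ s))   ≈⟨ +-assocₚ p r (q +ₚ s) ⟨
      (p +ₚ r) +ₚ (q +ₚ s)   ∎

    ·-cong : ∀ {a b p q} → a R.≈ b → p ≈ₚ q → a · p ≈ₚ b · q
    ·-cong {a} {b} {p} {q} a≈b e = mk≈ λ n →
      R.trans (coeff-· a p n)
        (R.trans (R.*-cong a≈b (coeff-≈ e n)) (R.sym (coeff-· b q n)))

    ·-distribˡ : ∀ a p q → a · (p +ₚ q) ≈ₚ a · p +ₚ a · q
    ·-distribˡ a p q = mk≈ λ n →
      R.trans (coeff-· a (p +ₚ q) n)
        (R.trans (R.*-congˡ (coeff-+ p q n))
          (R.trans (R.distribˡ a _ _)
            (R.trans (R.+-cong (R.sym (coeff-· a p n)) (R.sym (coeff-· a q n)))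
              (R.sym (coeff-+ (a · p) (a · q) n)))))

    ·-assoc : ∀ a b p → (a R.* b) · p ≈ₚ a · (b · p)
    ·-assoc a b p = mk≈ λ n →
      R.trans (coeff-· (a R.* b) p n)
        (R.trans (R.*-assoc a b _)
          (R.trans (R.*-congˡ (R.sym (coeff-· b p n))) (R.sym (coeff-· a (b · p) n))))

    ·-zero : ∀ p → R.0# · p ≈ₚ []
    ·-zero p = mk≈ λ n → R.trans (coeff-· R.0# p n) (R.zeroˡ _)

    ·-one : ∀ p → R.1# · p ≈ₚ p
    ·-one p = mk≈ λ n → R.trans (coeff-· R.1# p n) (R.*-identityˡ _)

    *-zeroʳₚ : ∀ p → p *ₚ [] ≈ₚ []
    *-zeroʳₚ []      = reflₚ
    *-zeroʳₚ (a ∷ p) = transₚ (∷-cong R.refl (*-zeroʳₚ p)) 0∷[]≈[]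

    *-∷ʳ : ∀ p b q → p *ₚ (b ∷ q) ≈ₚ b · p +ₚ (R.0# ∷ (p *ₚ q))
    *-∷ʳ []      b q = symₚ 0∷[]≈[]
    *-∷ʳ (a ∷ p) b q = ∷-cong (R.+-congʳ (R.*-comm a b)) (begin
      a · q +ₚ p *ₚ (b ∷ q)                       ≈⟨ +-congₚ (reflₚ {a · q}) (*-∷ʳ p b q) ⟩
      a · q +ₚ (b · p +ₚ (R.0# ∷ (p *ₚ q)))       ≈⟨ +-assocₚ (a · q) (b · p) _ ⟨
      (a · q +ₚ b · p) +ₚ (R.0# ∷ (p *ₚ q))       ≈⟨ +-congₚ (+-commₚ (a · q) (b · p)) reflₚ ⟩
      (b · p +ₚ a · q) +ₚ (R.0# ∷ (p *ₚ q))       ≈⟨ +-assocₚ (b · p) (a · q) _ ⟩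
      b · p +ₚ (a · q +ₚ (R.0# ∷ (p *ₚ q)))       ∎)

    *-commₚ : ∀ p q → p *ₚ q ≈ₚ q *ₚ p
    *-commₚ []      q = symₚ (*-zeroʳₚ q)
    *-commₚ (a ∷ p) q =
      transₚ (+-congₚ (reflₚ {a · q}) (∷-cong R.refl (*-commₚ p q))) (symₚ (*-∷ʳ q a p))

    *-congˡₚ : ∀ p {q q′} → q ≈ₚ q′ → p *ₚ q ≈ₚ p *ₚ q′
    *-congˡₚ []      e = reflₚ
    *-congˡₚ (a ∷ p) e = +-congₚ (·-cong R.refl e) (∷-cong R.refl (*-congˡₚ p e))

    *-congₚ : ∀ {p p′ q q′} → p ≈ₚ p′ → q ≈ₚ q′ → p *ₚ q ≈ₚ p′ *ₚ q′
    *-congₚ {p} {p′} {q} {q′} e e′ = begin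
      p *ₚ q    ≈⟨ *-congˡₚ p e′ ⟩
      p *ₚ q′   ≈⟨ *-commₚ p q′ ⟩
      q′ *ₚ p   ≈⟨ *-congˡₚ q′ e ⟩
      q′ *ₚ p′  ≈⟨ *-commₚ q′ p′ ⟩
      p′ *ₚ q′  ∎

    *-distribˡₚ : ∀ p q r → p *ₚ (q +ₚ r) ≈ₚ p *ₚ q +ₚ p *ₚ r
    *-distribˡₚ []      q r = reflₚ
    *-distribˡₚ (a ∷ p) q r = begin
      a · (q +ₚ r) +ₚ (R.0# ∷ (p *ₚ (q +ₚ r)))
        ≈⟨ +-congₚ (·-distribˡ a q r)
                   (∷-cong (R.sym (R.+-identityˡ R.0#)) (*-distribˡₚ p q r)) ⟩
      (a · q +ₚ a · r) +ₚ ((R.0# ∷ (p *ₚ q)) +ₚ (R.0# ∷ (p *ₚ r)))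
        ≈⟨ +-interchangeₚ (a · q) (a · r) _ _ ⟩
      (a ∷ p) *ₚ q +ₚ (a ∷ p) *ₚ r ∎

    *-distribʳₚ : ∀ p q r → (q +ₚ r) *ₚ p ≈ₚ q *ₚ p +ₚ r *ₚ p
    *-distribʳₚ p q r = begin
      (q +ₚ r) *ₚ p      ≈⟨ *-commₚ (q +ₚ r) p ⟩
      p *ₚ (q +ₚ r)      ≈⟨ *-distribˡₚ p q r ⟩
      p *ₚ q +ₚ p *ₚ r   ≈⟨ +-congₚ (*-commₚ p q) (*-commₚ p r) ⟩
      q *ₚ p +ₚ r *ₚ p   ∎

    ·-*-assoc : ∀ a p q → (a · p) *ₚ q ≈ₚ a · (p *ₚ q)
    ·-*-assoc a []      q = reflₚ
    ·-*-assoc a (b ∷ p) q = begin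
      (a R.* b) · q +ₚ (R.0# ∷ ((a · p) *ₚ q))
        ≈⟨ +-congₚ (·-assoc a b q) (∷-cong (R.sym (R.zeroʳ a)) (·-*-assoc a p q)) ⟩
      a · (b · q) +ₚ a · (R.0# ∷ (p *ₚ q))
        ≈⟨ ·-distribˡ a (b · q) (R.0# ∷ (p *ₚ q)) ⟨
      a · (b · q +ₚ (R.0# ∷ (p *ₚ q))) ∎

    *-assocₚ : ∀ p q r → (p *ₚ q) *ₚ r ≈ₚ p *ₚ (q *ₚ r)
    *-assocₚ []      q r = reflₚ
    *-assocₚ (a ∷ p) q r = begin
      (a · q +ₚ (R.0# ∷ (p *ₚ q))) *ₚ r
        ≈⟨ *-distribʳₚ r (a · q) (R.0# ∷ (p *ₚ q)) ⟩
      (a · q) *ₚ r +ₚ (R.0# · r +ₚ (R.0# ∷ ((p *ₚ q) *ₚ r)))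
        ≈⟨ +-congₚ (·-*-assoc a q r)
                   (+-congₚ (·-zero r) (∷-cong R.refl (*-assocₚ p q r))) ⟩
      a · (q *ₚ r) +ₚ (R.0# ∷ (p *ₚ (q *ₚ r))) ∎

    *-identityˡₚ : ∀ p → const R.1# *ₚ p ≈ₚ p
    *-identityˡₚ p = begin
      R.1# · p +ₚ (R.0# ∷ [])  ≈⟨ +-congₚ (·-one p) 0∷[]≈[] ⟩
      p +ₚ []                  ≈⟨ +-identityʳₚ p ⟩
      p                        ∎

  polyRing : CommutativeRing c ℓ
  polyRing = record
    { Carrier = Poly
    ; _≈_     = _≈ₚ_
    ; _+_     = _+ₚ_
    ; _*_     = _*ₚ_
    ; -_      = -ₚ_
    ; 0#      = []
    ; 1#      = const R.1#
    ; isCommutativeRing = record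
      { isRing = record
        { +-isAbelianGroup = record
          { isGroup = record
            { isMonoid = record
              { isSemigroup = record
                { isMagma = record
                  { isEquivalence = Setoid.isEquivalence setoidₚ
                  ; ∙-cong = +-congₚ
                  }
                ; assoc = +-assocₚ
                }
              ; identity = (λ _ → reflₚ) , +-identityʳₚ
              }
            ; inverse = (λ p → transₚ (+-commₚ (-ₚ p) p) (+-inverseʳₚ p)) , +-inverseʳₚ
            ; ⁻¹-cong = -‿congₚ
            }
          ; comm = +-commₚ
          }
        ; *-cong     = *-congₚ
        ; *-assoc    = *-assocₚ
        ; *-identity = *-identityˡₚ
                     , (λ p → transₚ (*-commₚ p (const R.1#)) (*-identityˡₚ p))
        ; distrib    = *-distribˡₚ , *-distribʳₚ
        }
      ; *-comm = *-commₚ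
      }
    }

module PolynomialsOver {c ℓ q} (𝔽 : FiniteField c ℓ q) where

  private module F = FiniteField 𝔽

  open UnivariatePolynomials F.commutativeRing public

  𝔸 : CommutativeRing c ℓ
  𝔸 = polyRing

  open CommutativeRing 𝔸 public using (_≈_; _≉_; _*_; 0#)
  open RawSemiringDefinitions (Semiring.rawSemiring (CommutativeRing.semiring 𝔸)) public
    using (_∣_; Irreducible; product; _^_)
  open Quotient 𝔸 public using (_≡_[mod_]; _/_)

  -- The zero polynomial is given degree 0; wherever deg 0 = -∞ would matter,
  -- the zero polynomial is treated separately.
  deg : Poly → ℕ
  deg []      = 0
  deg (a ∷ p) = if does (all? (F._≟ F.0#) p) then 0 else suc (deg p)

  NonConstant : Poly → Set
  NonConstant p = 0 ℕ.< deg p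

  Monic : Poly → Set ℓ
  Monic p = coeff p (deg p) F.≈ F.1#

  -- The complete set of representatives 𝒜_f of the residue classes modulo f.
  Representative : Poly → Poly → Set ℓ
  Representative f h = deg h ℕ.< deg f ⊎ h ≈ 0#

  ResidueMap : Poly → Poly → Set (c ⊔ ℓ)
  ResidueMap f g = Func (CommutativeRing.setoid (_/_ f)) (CommutativeRing.setoid (_/_ g))

  -- Since h divides g, the congruence modulo h does not depend on the
  -- polynomials by which σ represents its values (see Quotient.reduction).
  CongruencePreserving : (f g : Poly) → ResidueMap f g → Set (c ⊔ ℓ)
  CongruencePreserving f g σ =
    ∀ h₁ h₂ → Representative f h₁ → Representative f h₂ →
    ∀ h → h ∣ g → h₁ ≡ h₂ [mod h ] → to h₁ ≡ to h₂ [mod h ]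
    where open Func σ using (to)

{-# OPTIONS --safe #-}

-- If some deg Pᵢ < deg f, then Pᵢ and 0 are representatives congruent modulo Pᵢ
-- with different residues modulo f, so the map sending the class of 0 to 0 and
-- every other class to 1 does not preserve congruences modulo Pᵢ.  Conversely, a
-- divisor h of g is either a unit or divisible by some Pᵢ; in the latter case
-- two representatives congruent modulo h differ by a multiple of Pᵢ of degree
-- less than deg f ≤ deg Pᵢ, hence are equal.

module Submission where

open import Defs
open import Algebra.Bundles using (CommutativeRing)
import Algebra.Properties.Ring as RingProperties
import Algebra.Properties.Semiring.Divisibility as Divisibility
open import Data.Bool.Base using (if_then_else_)
open import Data.Fin.Base using (zero; suc)
open import Data.List.Base using ([]; _∷_)
open import Data.List.Relation.Unary.All using (All; []; _∷_; all?)
open import Data.Nat.Base as ℕ using (ℕ; zero; suc; z≤n; s≤s; _≤_; _<_)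
open import Data.Nat.Primality using (Prime)
import Data.Nat.Properties as ℕ
open import Data.Product.Base using (_,_; ∃-syntax)
open import Data.Sum.Base using (_⊎_; inj₁; inj₂; [_,_]′; map₁; map₂)
open import Data.Vec.Functional using (Vector)
open import Function.Base using (_∘_)
open import Function.Bundles using (Func; _⇔_; mk⇔)
open import Level using (Level; _⊔_)
open import Relation.Binary.PropositionalEquality as ≡ using (_≡_; _≢_)
import Relation.Binary.Reasoning.Setoid as SetoidReasoning
open import Relation.Nullary.Decidable using (Dec; yes; no; does; does-⇔; dec-true; dec-false; map′)
open import Relation.Nullary.Negation using (¬_)

-- Divisibility of sums and differences in a commutative ring.

module CommutativeRingDivisibility {c ℓ} (R : CommutativeRing c ℓ) where

  open CommutativeRing R
  open Divisibility semiring public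
    using (_∣_; _,_; _∣0; ∣-refl; ∣-trans; ∣-respʳ; x∣ʳyx; x∣ʳy⇒x∣ʳzy; ε∣ʳ_)
  open RingProperties ring

  ∣x∣y⇒∣x+y : ∀ {d x y} → d ∣ x → d ∣ y → d ∣ x + y
  ∣x∣y⇒∣x+y {d} (u , ud≈x) (v , vd≈y) = u + v , trans (distribʳ d u v) (+-cong ud≈x vd≈y)

  ∣x∣y⇒∣x-y : ∀ {d x y} → d ∣ x → d ∣ y → d ∣ x - y
  ∣x∣y⇒∣x-y {d} (u , ud≈x) (v , vd≈y) =
    u - v , trans ([y-z]x≈yx-zx d u v) (+-cong ud≈x (-‿cong vd≈y))

  ∣x-y∣y⇒∣x : ∀ {d x y} → d ∣ x - y → d ∣ y → d ∣ x
  ∣x-y∣y⇒∣x {x = x} {y} d∣x-y d∣y = ∣-respʳ (//-rightDividesˡ y x) (∣x∣y⇒∣x+y d∣x-y d∣y)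

  ∣x-y∣x⇒∣y : ∀ {d x y} → d ∣ x - y → d ∣ x → d ∣ y
  ∣x-y∣x⇒∣y {x = x} {y} d∣x-y d∣x = ∣-respʳ x-[x-y]≈y (∣x∣y⇒∣x-y d∣x d∣x-y)
    where
    x-[x-y]≈y : x - (x - y) ≈ y
    x-[x-y]≈y = trans (+-congˡ (⁻¹-anti-homo‿- x y))
      (trans (sym (+-assoc x y (- x))) (xyx⁻¹≈y x y))

-- Coefficients of polynomials and degree bounds.

module PolynomialCoefficients {c ℓ} (R : CommutativeRing c ℓ) where

  private module R = CommutativeRing R
  open RingProperties R.ring using (-0#≈0#; -‿+-comm)
  open UnivariatePolynomials R
  open SetoidReasoning R.setoid
  open CommutativeRing polyRing using (_-_; _≈_; 0#)

  coeff-+ : ∀ p q n → coeff (p +ₚ q) n R.≈ coeff p n R.+ coeff q n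
  coeff-+ []      q       n       = R.sym (R.+-identityˡ _)
  coeff-+ (a ∷ p) []      n       = R.sym (R.+-identityʳ _)
  coeff-+ (a ∷ p) (b ∷ q) zero    = R.refl
  coeff-+ (a ∷ p) (b ∷ q) (suc n) = coeff-+ p q n

  coeff-neg : ∀ p n → coeff (-ₚ p) n R.≈ R.- coeff p n
  coeff-neg []      n       = R.sym -0#≈0#
  coeff-neg (a ∷ p) zero    = R.refl
  coeff-neg (a ∷ p) (suc n) = coeff-neg p n

  coeff-· : ∀ a p n → coeff (a · p) n R.≈ a R.* coeff p n
  coeff-· a []      n       = R.sym (R.zeroʳ a)
  coeff-· a (b ∷ p) zero    = R.refl
  coeff-· a (b ∷ p) (suc n) = coeff-· a p n

  coeff-- : ∀ p q n → coeff (p - q) n R.≈ coeff p n R.- coeff q n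
  coeff-- p q n = R.trans (coeff-+ p (-ₚ q) n) (R.+-congˡ (coeff-neg q n))

  coeff-∷* : ∀ a p q n →
             coeff ((a ∷ p) *ₚ q) n R.≈ a R.* coeff q n R.+ coeff (R.0# ∷ (p *ₚ q)) n
  coeff-∷* a p q n = R.trans (coeff-+ (a · q) (R.0# ∷ (p *ₚ q)) n) (R.+-congʳ (coeff-· a q n))

  -- One step of long division: if p - qf is the remainder of p, then bringing
  -- down the coefficient a and adding the digit b to the quotient leaves this.
  coeff-division-step : ∀ a b p q f n →
    coeff ((a ∷ p) - (b ∷ q) *ₚ f) n R.≈ coeff (a ∷ (p - q *ₚ f)) n R.- b R.* coeff f n
  coeff-division-step a b p q f n = begin
    coeff ((a ∷ p) - (b ∷ q) *ₚ f) n
      ≈⟨ coeff-- (a ∷ p) ((b ∷ q) *ₚ f) n ⟩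
    coeff (a ∷ p) n R.- coeff ((b ∷ q) *ₚ f) n
      ≈⟨ R.+-congˡ (R.-‿cong (R.trans (coeff-∷* b q f n) (R.+-comm _ _))) ⟩
    coeff (a ∷ p) n R.- (y R.+ x)
      ≈⟨ R.+-congˡ (-‿+-comm y x) ⟨
    coeff (a ∷ p) n R.+ (R.- y R.- x)
      ≈⟨ R.+-assoc _ _ _ ⟨
    coeff (a ∷ p) n R.- y R.- x
      ≈⟨ R.+-congʳ (shift n) ⟩
    coeff (a ∷ (p - q *ₚ f)) n R.- x ∎
    where
    x = b R.* coeff f n
    y = coeff (R.0# ∷ (q *ₚ f)) n

    shift : ∀ n → coeff (a ∷ p) n R.- coeff (R.0# ∷ (q *ₚ f)) n R.≈ coeff (a ∷ (p - q *ₚ f)) n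
    shift zero    = R.trans (R.+-congˡ -0#≈0#) (R.+-identityʳ a)
    shift (suc n) = R.sym (coeff-- p (q *ₚ f) n)

  -- Encodes degree less than `n` with the zero polynomial included. Unlike a bound on `deg`, it
  -- remains meaningful at `n = 0`, where it forces the polynomial to be zero.
  VanishesFrom : ℕ → Poly → Set ℓ
  VanishesFrom n p = ∀ {m} → n ≤ m → coeff p m R.≈ R.0#

  vanishesFrom-0⇒≈0 : ∀ {p} → VanishesFrom 0 p → p ≈ 0#
  vanishesFrom-0⇒≈0 v = mk≈ λ n → v z≤n

  ≈0⇒vanishesFrom : ∀ {p n} → p ≈ 0# → VanishesFrom n p
  ≈0⇒vanishesFrom p≈0 {m} _ = coeff-≈ p≈0 m

  vanishesFrom-- : ∀ {n p q} → VanishesFrom n p → VanishesFrom n q → VanishesFrom n (p - q)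
  vanishesFrom-- {n} {p} {q} v w {m} n≤m = begin
    coeff (p - q) m          ≈⟨ coeff-- p q m ⟩
    coeff p m R.- coeff q m  ≈⟨ R.+-cong (v n≤m) (R.-‿cong (w n≤m)) ⟩
    R.0# R.- R.0#            ≈⟨ R.-‿inverseʳ R.0# ⟩
    R.0#                     ∎

-- Degree and division with remainder over a finite field.

module PolynomialDivision {c ℓ q} (𝔽 : FiniteField c ℓ q) where

  private
    module F  = FiniteField 𝔽
    module FP = RingProperties F.ring
    module FR = SetoidReasoning F.setoid
  open PolynomialsOver 𝔽 hiding (_≈_; _*_; 0#; _∣_)
  open CommutativeRing 𝔸 hiding (zero)
  open RingProperties ring using ([y-z]x≈yx-zx; x∙y⁻¹≈ε⇒x≈y)
  open CommutativeRingDivisibility 𝔸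
  open PolynomialCoefficients F.commutativeRing

  All-zero⇒≈0 : ∀ {p} → All (F._≈ F.0#) p → p ≈ 0#
  All-zero⇒≈0 []       = refl
  All-zero⇒≈0 (z ∷ zs) = mk≈ λ { zero → z ; (suc n) → coeff-≈ (All-zero⇒≈0 zs) n }

  ≈0⇒All-zero : ∀ p → p ≈ 0# → All (F._≈ F.0#) p
  ≈0⇒All-zero []      p≈0 = []
  ≈0⇒All-zero (a ∷ p) p≈0 = coeff-≈ p≈0 0 ∷ ≈0⇒All-zero p (mk≈ (coeff-≈ p≈0 ∘ suc))

  _≈0? : ∀ p → Dec (p ≈ 0#)
  p ≈0? = map′ All-zero⇒≈0 (≈0⇒All-zero p) (all? (F._≟ F.0#) p)

  -- Excludes the zero polynomial. The index is free rather than computed by `deg`, so that `euclid`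
  -- can supply it from its own degree bound.
  record HasDegree (p : Poly) (n : ℕ) : Set ℓ where
    field
      leading≉0 : coeff p n F.≉ F.0#
      vanishes  : VanishesFrom (suc n) p
  open HasDegree

  deg-vanishes : ∀ p → VanishesFrom (suc (deg p)) p
  deg-vanishes []      _ = F.refl
  deg-vanishes (a ∷ p) {suc m} (s≤s d≤m) with all? (F._≟ F.0#) p
  ... | yes zs = coeff-≈ (All-zero⇒≈0 zs) m
  ... | no  _  = deg-vanishes p d≤m

  ≉0⇒leading≉0 : ∀ p → ¬ All (F._≈ F.0#) p → coeff p (deg p) F.≉ F.0#
  ≉0⇒leading≉0 []      ¬zs _ = ¬zs []
  ≉0⇒leading≉0 (a ∷ p) ¬zs with all? (F._≟ F.0#) p
  ... | yes zs = λ z → ¬zs (z ∷ zs)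
  ... | no ¬zs = ≉0⇒leading≉0 p ¬zs

  nonConstant⇒hasDegree : ∀ p → NonConstant p → HasDegree p (deg p)
  nonConstant⇒hasDegree p 0<deg = record
    { leading≉0 = ≉0⇒leading≉0 p (nonzero p 0<deg)
    ; vanishes  = deg-vanishes p
    }
    where
    nonzero : ∀ p → NonConstant p → ¬ All (F._≈ F.0#) p
    nonzero (a ∷ p) 0<deg (_ ∷ zs) with all? (F._≟ F.0#) p
    ... | yes _  = ℕ.n≮0 0<deg
    ... | no ¬zs = ¬zs zs

  -- Long division by recursion on the coefficient list: the tail carries the higher coefficients
  -- and is divided first. Bringing down `a` raises the degree of the remainder to at most `n`, and
  -- the digit `b` cancels the coefficient at `n`.
  division : ∀ {f n} → HasDegree f n → ∀ p → ∃[ q ] VanishesFrom n (p - q * f)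
  division         f-deg []      = [] , λ _ → F.refl
  division {f} {n} f-deg (a ∷ p) with division f-deg p | F.invertible _ (leading≉0 f-deg)
  ... | q , rem-vanishes | y , fₙy≈1 = b ∷ q , λ {m} n≤m →
    F.trans (coeff-division-step a b p q f m) (new-vanishes (ℕ.m≤n⇒m<n∨m≡n n≤m))
    where
    s : Poly
    s = a ∷ (p - q * f)

    b : F.Carrier
    b = coeff s n F.* y

    bfₙ≈sₙ : b F.* coeff f n F.≈ coeff s n
    bfₙ≈sₙ = FR.begin
      coeff s n F.* y F.* coeff f n    FR.≈⟨ F.*-assoc _ _ _ ⟩
      coeff s n F.* (y F.* coeff f n)  FR.≈⟨ F.*-congˡ (F.trans (F.*-comm _ _) fₙy≈1) ⟩
      coeff s n F.* F.1#               FR.≈⟨ F.*-identityʳ _ ⟩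
      coeff s n                        FR.∎

    new-vanishes : ∀ {m} → n < m ⊎ n ≡ m → coeff s m F.- b F.* coeff f m F.≈ F.0#
    new-vanishes {suc m} (inj₁ (s≤s n≤m)) = FR.begin
      coeff s (suc m) F.- b F.* coeff f (suc m)
        FR.≈⟨ F.+-cong (rem-vanishes n≤m) (F.-‿cong (F.*-congˡ (vanishes f-deg (s≤s n≤m)))) ⟩
      F.0# F.- b F.* F.0#
        FR.≈⟨ F.+-congˡ (F.-‿cong (F.zeroʳ b)) ⟩
      F.0# F.- F.0#
        FR.≈⟨ F.-‿inverseʳ F.0# ⟩
      F.0# FR.∎
    new-vanishes (inj₂ ≡.refl) = F.trans (F.+-congˡ (F.-‿cong bfₙ≈sₙ)) (F.-‿inverseʳ _)

  -- Beyond degree `n` the term `a · f` contributes nothing, so `p * f` inherits the bound and `p`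
  -- is zero by induction. The coefficient of the product at `n` is then `a` times the invertible
  -- leading coefficient of `f`.
  *-vanishes⇒≈0 : ∀ {f n} → HasDegree f n → ∀ p → VanishesFrom n (p * f) → p ≈ 0#
  *-vanishes⇒≈0         f-deg []      v = refl
  *-vanishes⇒≈0 {f} {n} f-deg (a ∷ p) v = mk≈ λ { zero → a≈0 ; (suc m) → coeff-≈ p≈0 m }
    where
    pf-vanishes : VanishesFrom n (p * f)
    pf-vanishes {m} n≤m = FR.begin
      coeff (p * f) m
        FR.≈⟨ F.+-identityˡ _ ⟨
      F.0# F.+ coeff (p * f) m
        FR.≈⟨ F.+-congʳ (F.trans (F.*-congˡ (vanishes f-deg (s≤s n≤m))) (F.zeroʳ a)) ⟨
      a F.* coeff f (suc m) F.+ coeff (p * f) m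
        FR.≈⟨ coeff-∷* a p f (suc m) ⟨
      coeff ((a ∷ p) * f) (suc m)
        FR.≈⟨ v (ℕ.m≤n⇒m≤1+n n≤m) ⟩
      F.0# FR.∎

    p≈0 : p ≈ 0#
    p≈0 = *-vanishes⇒≈0 f-deg p pf-vanishes

    shifted≈0 : ∀ m → coeff (F.0# ∷ (p * f)) m F.≈ F.0#
    shifted≈0 zero    = F.refl
    shifted≈0 (suc m) = coeff-≈ (trans (*-congʳ p≈0) (zeroˡ f)) m

    afₙ≈0 : a F.* coeff f n F.≈ F.0#
    afₙ≈0 = FR.begin
      a F.* coeff f n                                  FR.≈⟨ F.+-identityʳ _ ⟨
      a F.* coeff f n F.+ F.0#                         FR.≈⟨ F.+-congˡ (shifted≈0 n) ⟨
      a F.* coeff f n F.+ coeff (F.0# ∷ (p * f)) n     FR.≈⟨ coeff-∷* a p f n ⟨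
      coeff ((a ∷ p) * f) n                            FR.≈⟨ v ℕ.≤-refl ⟩
      F.0#                                             FR.∎

    a≈0 : a F.≈ F.0#
    a≈0 with F.invertible _ (leading≉0 f-deg)
    ... | y , fₙy≈1 = FR.begin
      a                          FR.≈⟨ F.*-identityʳ a ⟨
      a F.* F.1#                 FR.≈⟨ F.*-congˡ fₙy≈1 ⟨
      a F.* (coeff f n F.* y)    FR.≈⟨ F.*-assoc _ _ _ ⟨
      a F.* coeff f n F.* y      FR.≈⟨ F.*-congʳ afₙ≈0 ⟩
      F.0# F.* y                 FR.≈⟨ F.zeroˡ y ⟩
      F.0#                       FR.∎

  ∣∧vanishes⇒≈0 : ∀ {f n x} → HasDegree f n → f ∣ x → VanishesFrom n x → x ≈ 0#
  ∣∧vanishes⇒≈0 {f} f-deg (u , uf≈x) v =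
    trans (sym uf≈x) (trans (*-congʳ u≈0) (zeroˡ f))
    where
    u≈0 : u ≈ 0#
    u≈0 = *-vanishes⇒≈0 f-deg u λ {m} n≤m → F.trans (coeff-≈ uf≈x m) (v n≤m)

  -- Decided by whether the remainder is zero: if `f` divides `x`, it also divides the remainder,
  -- whose degree is too small for a nonzero multiple.
  divides? : ∀ {f n} → HasDegree f n → ∀ x → Dec (f ∣ x)
  divides? {f} f-deg x with division f-deg x
  ... | q , v = map′
    (λ x-qf≈0 → q , sym (x∙y⁻¹≈ε⇒x≈y x (q * f) x-qf≈0))
    (λ f∣x → ∣∧vanishes⇒≈0 f-deg (∣x∣y⇒∣x-y f∣x (x∣ʳyx f q)) v)
    ((x - q * f) ≈0?)

  -- Greatest common divisors and divisors of products of irreducibles.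

  -- Multiplying by an arbitrary x in the universal property stands in for the
  -- Bézout identity: dx lies in every principal ideal containing ax and bx.
  record GCD (a b : Poly) : Set (c ⊔ ℓ) where
    field
      gcd       : Poly
      gcd∣a     : gcd ∣ a
      gcd∣b     : gcd ∣ b
      universal : ∀ {x z} → z ∣ a * x → z ∣ b * x → z ∣ gcd * x

  euclid : ∀ n a b → VanishesFrom n b → GCD a b
  euclid zero a b v = record
    { gcd       = a
    ; gcd∣a     = ∣-refl
    ; gcd∣b     = ∣-respʳ (sym (vanishesFrom-0⇒≈0 v)) (a ∣0)
    ; universal = λ z∣ax _ → z∣ax
    }
  euclid (suc n) a b v with coeff b n F.≟ F.0#
  -- The fuel is only an upper bound for the degree of `b`; when it is not sharp, it is lowered
  -- without dividing.
  ... | yes bₙ≈0 = euclid n a b λ n≤m →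
    [ v , (λ { ≡.refl → bₙ≈0 }) ]′ (ℕ.m≤n⇒m<n∨m≡n n≤m)
  ... | no bₙ≉0 with division (record { leading≉0 = bₙ≉0 ; vanishes = v }) a
  ... | q , r-vanishes = record
    { gcd       = gcd
    ; gcd∣a     = ∣x-y∣y⇒∣x gcd∣b (x∣ʳy⇒x∣ʳzy q gcd∣a)
    ; gcd∣b     = gcd∣a
    ; universal = λ {x} z∣ax z∣bx → universal z∣bx
        (∣-respʳ (sym ([y-z]x≈yx-zx x a (q * b)))
          (∣x∣y⇒∣x-y z∣ax (∣-respʳ (sym (*-assoc q b x)) (x∣ʳy⇒x∣ʳzy q z∣bx))))
    }
    where open GCD (euclid n b (a - q * b) r-vanishes)

  -- In `p ≈ s * d`, with `d` the gcd of `p` and `h`, one factor is a unit. If it is `s`, then `p`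
  -- divides `d` and hence `h`. If it is `d`, then `h` divides both `p * x` and `h * x`, hence
  -- `d * x`, hence `x`.
  irreducible-∣* : ∀ {p} → Irreducible p → ∀ {h x} → h ∣ p * x → p ∣ h ⊎ h ∣ x
  irreducible-∣* {p} p-irr {h} {x} h∣px with euclid _ p h (deg-vanishes h)
  ... | record { gcd = d ; gcd∣a = s , sd≈p ; gcd∣b = d∣h ; universal = universal }
    with Irreducible.split-∣1 p-irr (sym sd≈p)
  ...   | inj₁ (t , ts≈1) = inj₁ (∣-trans (t , tp≈d) d∣h)
    where
    tp≈d : t * p ≈ d
    tp≈d = trans (*-congˡ {t} (sym sd≈p))
      (trans (sym (*-assoc t s d)) (trans (*-congʳ ts≈1) (*-identityˡ d)))
  ...   | inj₂ (t , td≈1) =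
    inj₂ (∣-respʳ t[dx]≈x (x∣ʳy⇒x∣ʳzy t (universal h∣px (x , *-comm x h))))
    where
    t[dx]≈x : t * (d * x) ≈ x
    t[dx]≈x = trans (sym (*-assoc t d x)) (trans (*-congʳ td≈1) (*-identityˡ x))

  irreducible-∣^* : ∀ {p} → Irreducible p → ∀ n {h x} → h ∣ p ^ n * x → p ∣ h ⊎ h ∣ x
  irreducible-∣^* p-irr zero    {x = x} h∣x = inj₂ (∣-respʳ (*-identityˡ x) h∣x)
  irreducible-∣^* {p} p-irr (suc n) {x = x} h∣ppⁿx =
    [ inj₁ , irreducible-∣^* p-irr n ]′
      (irreducible-∣* p-irr (∣-respʳ (*-assoc p (p ^ n) x) h∣ppⁿx))

  -- The prime powers are stripped one at a time while `h` stays fixed. The cofactor `x` gives the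
  -- induction room and later takes the unit `const α`.
  ∣product*⇒ : ∀ {r} (P : Vector Poly r) (e : Vector ℕ r) → (∀ i → Irreducible (P i)) →
               ∀ {h x} → h ∣ product (λ i → P i ^ e i) * x → (∃[ i ] P i ∣ h) ⊎ h ∣ x
  ∣product*⇒ {zero}  P e P-irr {x = x} h∣x = inj₂ (∣-respʳ (*-identityˡ x) h∣x)
  ∣product*⇒ {suc r} P e P-irr {x = x} h∣Πx =
    [ (λ P₀∣h → inj₁ (zero , P₀∣h))
    , (λ h∣Π′x → map₁ (λ (i , Pᵢ∣h) → suc i , Pᵢ∣h)
        (∣product*⇒ (P ∘ suc) (e ∘ suc) (P-irr ∘ suc) h∣Π′x))
    ]′ (irreducible-∣^* (P-irr zero) (e zero) (∣-respʳ (*-assoc (P zero ^ e zero) Π′ x) h∣Πx))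
    where
    Π′ : Poly
    Π′ = product (λ i → P (suc i) ^ e (suc i))

  ∣product : ∀ {r} (Q : Vector Poly r) i → Q i ∣ product Q
  ∣product Q zero    = product (Q ∘ suc) , *-comm (product (Q ∘ suc)) (Q zero)
  ∣product Q (suc i) = x∣ʳy⇒x∣ʳzy (Q zero) (∣product (Q ∘ suc) i)

  ∣^ : ∀ p {n} → 1 ≤ n → p ∣ p ^ n
  ∣^ p {suc n} _ = p ^ n , *-comm (p ^ n) p

  const-∣1 : ∀ {α} → α F.≉ F.0# → const α ∣ 1#
  const-∣1 {α} α≉0 with F.invertible α α≉0
  ... | β , αβ≈1 = const β , mk≈ λ
    { zero    → F.trans (F.+-identityʳ _) (F.trans (F.*-comm β α) αβ≈1)
    ; (suc n) → F.refl
    }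

  -- Representatives and the indicator of the zero class.

  representative⇒vanishes : ∀ {f} h → Representative f h → VanishesFrom (deg f) h
  representative⇒vanishes h (inj₁ deg-h<deg-f) deg-f≤m =
    deg-vanishes h (ℕ.≤-trans deg-h<deg-f deg-f≤m)
  representative⇒vanishes h (inj₂ h≈0) = ≈0⇒vanishesFrom h≈0

  indicator : ∀ f g → NonConstant f → ResidueMap f g
  indicator f g f-nc = record
    { to   = λ x → if does (f∣? x) then 0# else 1#
    -- Congruent arguments are both divisible by `f` or both not, so the two decisions give the same
    -- Boolean and the values coincide.
    ; cong = λ {x} {y} f∣x-y → CommutativeRing.reflexive (_/_ g)
        (≡.cong (if_then 0# else 1#)
          (does-⇔ (mk⇔ (∣x-y∣x⇒∣y f∣x-y) (∣x-y∣y⇒∣x f∣x-y)) (f∣? x) (f∣? y)))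
    }
    where f∣? = divides? (nonConstant⇒hasDegree f f-nc)

  indicator-preserving⇒ : ∀ f g (f-nc : NonConstant f) →
    CongruencePreserving f g (indicator f g f-nc) →
    ∀ {h} → NonConstant h → deg h < deg f → h ∣ g → h ∣ 1#
  indicator-preserving⇒ f g f-nc preserving {h} h-nc deg-h<deg-f h∣g =
    -- Comparing `h` with `0#` modulo `h` turns preservation into `h` dividing `1# - 0#`.
    ∣x-y∣y⇒∣x (≡.subst₂ (λ x y → h ∣ x - y) σh≡1 σ0≡0 h∣σh-σ0) (h ∣0)
    where
    open Func (indicator f g f-nc) using (to)

    f-deg : HasDegree f (deg f)
    f-deg = nonConstant⇒hasDegree f f-nc

    f∤h : ¬ f ∣ h
    f∤h f∣h = leading≉0 (nonConstant⇒hasDegree h h-nc) (coeff-≈ h≈0 (deg h))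
      where
      h≈0 : h ≈ 0#
      h≈0 = ∣∧vanishes⇒≈0 f-deg f∣h (representative⇒vanishes {f} h (inj₁ deg-h<deg-f))

    h∣σh-σ0 : h ∣ to h - to 0#
    h∣σh-σ0 = preserving h 0# (inj₁ deg-h<deg-f) (inj₂ refl) h h∣g (∣x∣y⇒∣x-y ∣-refl (h ∣0))

    σh≡1 : to h ≡ 1#
    σh≡1 = ≡.cong (if_then 0# else 1#) (dec-false (divides? f-deg h) f∤h)

    σ0≡0 : to 0# ≡ 0#
    σ0≡0 = ≡.cong (if_then 0# else 1#) (dec-true (divides? f-deg 0#) (f ∣0))

  representatives-≡⇒≈ : ∀ {f h₁ h₂ p} → Representative f h₁ → Representative f h₂ →
    NonConstant p → deg f ≤ deg p → h₁ ≡ h₂ [mod p ] → h₁ ≈ h₂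
  representatives-≡⇒≈ {f} {h₁} {h₂} {p} rep₁ rep₂ p-nc deg-f≤deg-p p∣h₁-h₂ =
    x∙y⁻¹≈ε⇒x≈y h₁ h₂ (∣∧vanishes⇒≈0 (nonConstant⇒hasDegree p p-nc) p∣h₁-h₂
      (vanishesFrom-- {p = h₁} (vanish h₁ rep₁) (vanish h₂ rep₂)))
    where
    vanish : ∀ h → Representative f h → VanishesFrom (deg p) h
    vanish h rep deg-p≤m = representative⇒vanishes {f} h rep (ℕ.≤-trans deg-f≤deg-p deg-p≤m)

corollary1p6 : ∀ {c ℓ : Level} (p k q : ℕ) → Prime p → 1 ≤ k → q ≡ p ℕ.^ k →
    (𝔽 : FiniteField c ℓ q) →
    let module F = FiniteField 𝔽
        open PolynomialsOver 𝔽
    in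
    (f g : Poly) → NonConstant f → NonConstant g →
    (r : ℕ) (α : F.Carrier) (P : Vector Poly r) (e : Vector ℕ r) →
    α F.≉ F.0# →
    (∀ i → 1 ≤ e i) →
    (∀ i → Monic (P i)) →
    (∀ i → Irreducible (P i)) →
    (∀ i → 0 < deg (P i)) →
    (∀ i j → i ≢ j → P i ≉ P j) →
    g ≈ const α * product (λ i → P i ^ e i) →
    (∀ (σ : ResidueMap f g) → CongruencePreserving f g σ) ⇔ (∀ i → deg f ≤ deg (P i))
corollary1p6 _ _ _ _ _ _ 𝔽 f g f-nc _ r α P e α≉0 1≤e _ P-irr P-nc _ g≈ = mk⇔ forward backward
  where
  open PolynomialsOver 𝔽
  open PolynomialDivision 𝔽
  open CommutativeRing 𝔸 using (trans; sym; *-comm; 1#)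
  open CommutativeRingDivisibility 𝔸 hiding (_∣_; _,_)

  P∣g : ∀ i → P i ∣ g
  P∣g i = ∣-respʳ (sym g≈) (x∣ʳy⇒x∣ʳzy (const α)
    (∣-trans (∣^ (P i) (1≤e i)) (∣product (λ i → P i ^ e i) i)))

  prime-factor : ∀ {h} → h ∣ g → (∃[ i ] P i ∣ h) ⊎ h ∣ 1#
  prime-factor h∣g =
    map₂ (λ h∣α → ∣-trans h∣α (const-∣1 α≉0))
      (∣product*⇒ P e P-irr (∣-respʳ (trans g≈ (*-comm (const α) _)) h∣g))

  forward : (∀ σ → CongruencePreserving f g σ) → ∀ i → deg f ≤ deg (P i)
  forward preserving i = ℕ.≮⇒≥ λ deg-Pᵢ<deg-f →
    Irreducible.p∤1 (P-irr i)
      (indicator-preserving⇒ f g f-nc (preserving (indicator f g f-nc)) (P-nc i) deg-Pᵢ<deg-f (P∣g i))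

  backward : (∀ i → deg f ≤ deg (P i)) → ∀ σ → CongruencePreserving f g σ
  backward deg-f≤ σ h₁ h₂ rep₁ rep₂ h h∣g h₁≡h₂ with prime-factor h∣g
  -- Modulo a unit any two values are congruent.
  ... | inj₂ h∣1 = ∣-trans h∣1 (ε∣ʳ _)
  -- Equal representatives lie in the same class modulo `f`, so `σ` gives values congruent modulo
  -- `g`, and hence modulo its divisor `h`.
  ... | inj₁ (i , Pᵢ∣h) = ∣-trans h∣g (Func.cong σ (reflexive-mod
          (representatives-≡⇒≈ {f} rep₁ rep₂ (P-nc i) (deg-f≤ i) (∣-trans Pᵢ∣h h₁≡h₂))))
    where
    reflexive-mod : ∀ {x y} → x ≈ y → x ≡ y [mod f ]
    reflexive-mod x≈y = ∣-respʳ (sym (RingProperties.x≈y⇒x∙y⁻¹≈ε (CommutativeRing.ring 𝔸) x≈y)) (f ∣0)
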